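{- For all $k$, $D_k(x_1,x_2)\le D_{k+1}(x_1,x_2)$. Here $k\ge 2$ is an integer and $x_1,x_2\ge 0$ satisfy $x_1+x_2\le 1$ (with $x_1+x_2=1$ when $k=2$, so that $D_k(x_1,x_2)$ is defined).
   Context: The $k$-simplex is $\{x\in\mathbb{R}^k: x\ge 0,\ \sum_i x_i=1\}$. Let $F(z)=\min\{(11/6)z,1\}$ for $z\in[0,1]$, and let $F'(z)=11/6$ for $z\in[0,6/11]$ and $F'(z)=0$ otherwise. For a point $(x_1,\dots,x_k)$ of the $k$-simplex define $$d_k(x_1,\ldots,x_k)=\frac{1}{k!}\sum_{\sigma}\Big(F'(x_1)\prod_{i:\sigma(i)<\sigma(1)}[1-F(x_i)]+F'(x_2)\prod_{i:\sigma(i)<\sigma(2)}[1-F(x_i)]\Big),$$ the sum being over all permutations $\sigma$ of $\{1,\dots,k\}$. Define $D_k(x_1,x_2)=\max_{x_3,\ldots,x_k}d_k(x_1,x_2,\ldots,x_k)$, the maximum being over all $x_3,\dots,x_k$ such that $(x_1,\dots,x_k)$ lies in the $k$-simplex. -}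

module Defs where

open import Level using (Level; _⊔_; 0ℓ) renaming (suc to lsuc)
open import Algebra.Bundles using (CommutativeRing)
open import Algebra.Core using (Op₁)
import Algebra.Construct.NaturalChoice.Min as Min
import Algebra.Properties.Monoid.Mult as Mult
import Algebra.Properties.Monoid.Sum as Sum
open import Data.Fin.Base using (Fin; fromℕ; punchIn)
open import Data.Fin.Patterns using (0F; 1F)
open import Data.Fin.Permutation as Perm using (Permutation′; _⟨$⟩ʳ_; insert; remove)
open import Data.Fin.Properties as Finₚ using (punchIn-injective)
open import Data.List.Base as List using (List; []; _∷_; allFin; cartesianProductWith; filter; foldr)
open import Data.List.Membership.Propositional.Properties using (∈-allFin)
import Data.List.Membership.Setoid as Membership
open import Data.List.Membership.Setoid.Properties using (∈-cartesianProductWith⁺; ∈-resp-≈)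
open import Data.List.Relation.Unary.All using ([])
open import Data.List.Relation.Unary.AllPairs using ([]; _∷_)
open import Data.List.Relation.Unary.Any using (here)
open import Data.List.Relation.Unary.Unique.Setoid using (Unique)
import Data.List.Relation.Unary.Unique.Setoid.Properties as Unique
open import Data.Nat.Base as ℕ using (ℕ; zero; suc; _!)
open import Data.Product.Base using (_×_; _,_; ∃-syntax)
open import Data.Vec.Functional as Vector using (Vector)
open import Data.Bool.Base using (if_then_else_)
open import Relation.Binary.Bundles using (DecTotalOrder; Setoid)
open import Relation.Binary.Core using (Rel)
open import Relation.Binary.PropositionalEquality as ≡ using (_≡_)
open import Relation.Binary.Structures using (IsDecTotalOrder)
open import Relation.Nullary using (¬_; yes; no; does; _×-dec_; contradiction)
open import Relation.Unary using (Pred; _∈_)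

-- The real numbers, characterised (uniquely up to isomorphism) as a
-- Dedekind-complete ordered field.  The order is decidable, as in classical
-- mathematics; this is what makes the discontinuous function F′ below a
-- function.  The value of 0# ⁻¹ is left unspecified.
record CompleteOrderedField c ℓ₁ ℓ₂ : Set (lsuc (c ⊔ ℓ₁ ⊔ ℓ₂)) where
  infix 4 _≤_
  infix 8 _⁻¹
  field
    commutativeRing : CommutativeRing c ℓ₁

  open CommutativeRing commutativeRing public

  field
    0≉1     : ¬ 0# ≈ 1#
    _⁻¹     : Op₁ Carrier
    ⁻¹-cong : ∀ {x y} → x ≈ y → x ⁻¹ ≈ y ⁻¹
    ⁻¹-inverseʳ : ∀ {x} → ¬ x ≈ 0# → x * x ⁻¹ ≈ 1#

    _≤_             : Rel Carrier ℓ₂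
    isDecTotalOrder : IsDecTotalOrder _≈_ _≤_
    +-monoˡ-≤       : ∀ {x y} z → x ≤ y → x + z ≤ y + z
    *-nonNegative   : ∀ {x y} → 0# ≤ x → 0# ≤ y → 0# ≤ x * y

  decTotalOrder : DecTotalOrder c ℓ₁ ℓ₂
  decTotalOrder = record { isDecTotalOrder = isDecTotalOrder }

  open DecTotalOrder decTotalOrder public using (totalOrder; _≤?_)

  IsUpperBound : ∀ {ℓ} → Pred Carrier ℓ → Pred Carrier (c ⊔ ℓ₂ ⊔ ℓ)
  IsUpperBound S u = ∀ y → y ∈ S → y ≤ u

  IsMaximum : ∀ {ℓ} → Pred Carrier ℓ → Pred Carrier (c ⊔ ℓ₂ ⊔ ℓ)
  IsMaximum S m = m ∈ S × IsUpperBound S m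

  field
    complete : (S : Pred Carrier (c ⊔ ℓ₁ ⊔ ℓ₂)) → (∃[ y ] y ∈ S) → (∃[ u ] IsUpperBound S u) →
               ∃[ s ] IsUpperBound S s × (∀ u → IsUpperBound S u → s ≤ u)

-- A permutation of Fin (suc n) is determined by the image j of the last
-- element together with a permutation of Fin n.
permutations : ∀ n → List (Permutation′ n)
permutations zero    = Perm.id ∷ []
permutations (suc n) = cartesianProductWith (insert (fromℕ n)) (allFin (suc n)) (permutations n)

-- Permutations are compared by their action.  The list contains every
-- permutation exactly once.
Permutationₛ : ℕ → Setoid 0ℓ 0ℓ
Permutationₛ n = record
  { Carrier       = Permutation′ n
  ; _≈_           = Perm._≈_
  ; isEquivalence = record
    { refl  = λ _ → ≡.refl
    ; sym   = λ p i → ≡.sym (p i)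
    ; trans = λ p q i → ≡.trans (p i) (q i)
    }
  }

insert-at : ∀ {n} i j (π : Permutation′ n) → insert i j π ⟨$⟩ʳ i ≡ j
insert-at i j π with i Finₚ.≟ i
... | yes _   = ≡.refl
... | no  i≢i = contradiction ≡.refl i≢i

insert-cong : ∀ {n} i {j j′} {π π′ : Permutation′ n} → j ≡ j′ → π Perm.≈ π′ →
              insert i j π Perm.≈ insert i j′ π′
insert-cong i {j} ≡.refl π≈π′ k with i Finₚ.≟ k
... | yes _ = ≡.refl
... | no  _ = ≡.cong (punchIn j) (π≈π′ _)

insert-injective : ∀ {n} i {j j′} {π π′ : Permutation′ n} →
                   insert i j π Perm.≈ insert i j′ π′ → j ≡ j′ × π Perm.≈ π′
insert-injective i {j} {j′} {π} {π′} eq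
  with ≡.trans (≡.sym (insert-at i j π)) (≡.trans (eq i) (insert-at i j′ π′))
... | ≡.refl = ≡.refl , λ k → punchIn-injective j _ _
  (≡.trans (≡.sym (Perm.insert-punchIn i j π k))
    (≡.trans (eq (punchIn i k)) (Perm.insert-punchIn i j π′ k)))

permutations-complete : ∀ n (π : Permutation′ n) →
                        let open Membership (Permutationₛ n) renaming (_∈_ to _∈ₚ_) in
                        π ∈ₚ permutations n
permutations-complete zero    π = here (λ ())
permutations-complete (suc n) π =
  ∈-resp-≈ (Permutationₛ (suc n))
    {x = insert (fromℕ n) (π ⟨$⟩ʳ fromℕ n) (remove (fromℕ n) π)} {y = π}
    (Perm.insert-remove (fromℕ n) π)
    (∈-cartesianProductWith⁺ (≡.setoid _) (Permutationₛ n) (Permutationₛ (suc n))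
      (λ {_} {_} {π₁} {π₂} → insert-cong (fromℕ n) {π = π₁} {π₂})
      (∈-allFin (π ⟨$⟩ʳ fromℕ n))
      (permutations-complete n (remove (fromℕ n) π)))

permutations-unique : ∀ n → Unique (Permutationₛ n) (permutations n)
permutations-unique zero    = [] ∷ []
permutations-unique (suc n) =
  Unique.cartesianProductWith⁺ (≡.setoid _) (Permutationₛ n) (Permutationₛ (suc n))
    (insert (fromℕ n))
    (λ {_} {_} {π₁} {π₂} → insert-injective (fromℕ n) {π = π₁} {π₂})
    (Unique.tabulate⁺ (≡.setoid _) (λ eq → eq))
    (permutations-unique n)

preceding : ∀ {k} → Permutation′ k → Fin k → List (Fin k)
preceding {k} σ j = filter (λ i → (σ ⟨$⟩ʳ i) Finₚ.<? (σ ⟨$⟩ʳ j)) (allFin k)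

module _ {c ℓ₁ ℓ₂ : Level} (ℝ : CompleteOrderedField c ℓ₁ ℓ₂) where
  open CompleteOrderedField ℝ
  open Mult +-monoid using () renaming (_×_ to _·_)
  open Sum +-monoid using (sum)
  open Min totalOrder using (_⊓_)

  infixl 7 _/_
  _/_ : ℕ → ℕ → Carrier
  m / n = (m · 1#) * (n · 1#) ⁻¹

  ∑ : ∀ {a} {A : Set a} → List A → (A → Carrier) → Carrier
  ∑ as f = foldr _+_ 0# (List.map f as)

  ∏ : ∀ {a} {A : Set a} → List A → (A → Carrier) → Carrier
  ∏ as f = foldr _*_ 1# (List.map f as)

  Simplex : ∀ k → Pred (Vector Carrier k) (ℓ₁ ⊔ ℓ₂)
  Simplex k x = (∀ i → 0# ≤ x i) × sum x ≈ 1#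

  -- F and F′ are only ever applied to points of [0,1].
  F : Carrier → Carrier
  F z = ((11 / 6) * z) ⊓ 1#

  F′ : Carrier → Carrier
  F′ z = if does ((0# ≤? z) ×-dec (z ≤? 6 / 11)) then 11 / 6 else 0#

  term : ∀ {k} → Vector Carrier k → Permutation′ k → Fin k → Carrier
  term x σ j = F′ (x j) * ∏ (preceding σ j) (λ i → 1# - F (x i))

  -- d m is the function d_k for k = m + 2; the coordinates x_1, x_2, … are
  -- x 0F, x 1F, ….
  d : ∀ m → Vector Carrier (2 ℕ.+ m) → Carrier
  d m x = (1 / ((2 ℕ.+ m) !)) * ∑ (permutations (2 ℕ.+ m)) (λ σ → term x σ 0F + term x σ 1F)

  -- The set of values over which the maximum defining D_k(x₁, x₂) is taken,
  -- for k = m + 2.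
  Values : ∀ m → Carrier → Carrier → Pred Carrier (c ⊔ ℓ₁ ⊔ ℓ₂)
  Values m x₁ x₂ v = ∃[ xs ] let x = x₁ Vector.∷ x₂ Vector.∷ xs in
                     x ∈ Simplex (2 ℕ.+ m) × v ≈ d m x

  -- IsD m x₁ x₂ v says that D_k(x₁, x₂) = v, for k = m + 2.
  IsD : ∀ m → Carrier → Carrier → Pred Carrier (c ⊔ ℓ₁ ⊔ ℓ₂)
  IsD m x₁ x₂ = IsMaximum (Values m x₁ x₂)

{-# OPTIONS --safe #-}
-- Appending a zero coordinate to a point of the k-simplex gives a point of the
-- (k+1)-simplex at which d takes the same value: as 1 - F(0) = 1, the new
-- coordinate contributes only trivial factors, and each permutation of
-- {1,…,k} is induced by exactly k + 1 permutations of {1,…,k+1}, which is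
-- compensated by the normalisation 1/(k+1)!.
module Submission where

open import Defs
open import Level using (Level)
import Algebra.Construct.NaturalChoice.Min as Min
import Algebra.Properties.CommutativeMonoid.Sum as CommutativeMonoidSum
import Algebra.Properties.Ring as RingProperties
import Algebra.Properties.Semiring.Mult as SemiringMult
open import Data.Bool.Base using (true; false; if_then_else_)
open import Data.Fin.Base using (Fin; suc; fromℕ; punchIn; _<_)
open import Data.Fin.Patterns using (0F; 1F)
open import Data.Fin.Permutation using (Permutation′; _⟨$⟩ʳ_; insert; insert-punchIn)
open import Data.Fin.Properties using (_≟_; _<?_; punchIn-mono-≤; punchIn-cancel-≤; punchIn-punchOut)
open import Data.List.Base as List using ([]; _∷_; _++_; allFin; cartesianProductWith; filter; foldr; length; tabulate)
open import Data.List.Properties using (length-tabulate; map-tabulate)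
open import Data.Nat.Base as ℕ using (ℕ; zero; suc; NonZero; _!)
open import Data.Nat.Properties using (_!≢0; <⇒≱; ≰⇒>)
open import Data.Product.Base using (_,_)
open import Data.Sum.Base using (inj₁; inj₂)
open import Data.Vec.Functional as Vector using (Vector; insertAt; removeAt)
open import Data.Vec.Functional.Properties using (insertAt-lookup; removeAt-insertAt)
open import Function.Base using (_∘_; id)
open import Function.Bundles using (_⇔_; mk⇔)
open import Relation.Binary.Bundles using (TotalOrder)
open import Relation.Binary.PropositionalEquality as ≡ using (_≡_; _≗_)
import Relation.Binary.Reasoning.Setoid as SetoidReasoning
open import Relation.Nullary using (¬_; yes; no; does)
open import Relation.Nullary.Decidable using (does-⇔)
open import Relation.Unary using (Pred; Decidable; _∈_)

punchIn-<-⇔ : ∀ {n} j (a b : Fin n) → punchIn j a < punchIn j b ⇔ a < b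
punchIn-<-⇔ j a b = mk⇔
  (λ lt → ≰⇒> (<⇒≱ lt ∘ punchIn-mono-≤ j b a))
  (λ lt → ≰⇒> (<⇒≱ lt ∘ punchIn-cancel-≤ j b a))

-- Away from `p`, the values of `insert p j π` are those of `π` pushed through `punchIn j`, which is
-- strictly increasing. So the other coordinates keep their relative order.
insert-<-⇔ : ∀ {n} p j (π : Permutation′ n) a b →
             (insert p j π ⟨$⟩ʳ punchIn p a < insert p j π ⟨$⟩ʳ punchIn p b) ⇔
             (π ⟨$⟩ʳ a < π ⟨$⟩ʳ b)
insert-<-⇔ p j π a b
  rewrite insert-punchIn p j π a | insert-punchIn p j π b =
  punchIn-<-⇔ j (π ⟨$⟩ʳ a) (π ⟨$⟩ʳ b)

module _ {c ℓ₁ ℓ₂ : Level} (ℝ : CompleteOrderedField c ℓ₁ ℓ₂) where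
  open CompleteOrderedField ℝ hiding (zero)
  open TotalOrder totalOrder using (total; antisym; ≤-respˡ-≈; ≤-respʳ-≈)
    renaming (trans to ≤-trans; reflexive to ≤-reflexive)
  open SemiringMult semiring using (×1-homo-*; ×-assoc-*; ×-congʳ)
    renaming (_×_ to _·_)
  open RingProperties ring using (-‿distribˡ-*; -‿involutive; -0#≈0#)
  open Min totalOrder using (x≤y⇒x⊓y≈x)
  open CommutativeMonoidSum +-commutativeMonoid using (sum; sum-remove; sum-cong-≗)
  -- Over the multiplicative monoid the generic `sum` is a product, so `Product.sum` multiplies.
  module Product = CommutativeMonoidSum *-commutativeMonoid
  open SetoidReasoning setoid

  0≤1 : 0# ≤ 1#
  0≤1 with total 0# 1#
  ... | inj₁ 0≤1 = 0≤1
  -- If 1 ≤ 0 then -1 is nonnegative, and hence so is its square, which is 1.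
  ... | inj₂ 1≤0 = ≤-respʳ-≈ [-1]²≈1 (*-nonNegative 0≤-1 0≤-1)
    where
    0≤-1 : 0# ≤ - 1#
    0≤-1 = ≤-respˡ-≈ (-‿inverseʳ 1#) (≤-respʳ-≈ (+-identityˡ _) (+-monoˡ-≤ (- 1#) 1≤0))

    [-1]²≈1 : - 1# * - 1# ≈ 1#
    [-1]²≈1 = begin
      - 1# * - 1#     ≈⟨ -‿distribˡ-* 1# (- 1#) ⟨
      - (1# * - 1#)   ≈⟨ -‿cong (*-identityˡ (- 1#)) ⟩
      - - 1#          ≈⟨ -‿involutive 1# ⟩
      1#              ∎

  1≤[1+n]·1 : ∀ n → 1# ≤ suc n · 1#
  1≤[1+n]·1 zero    = ≤-reflexive (sym (+-identityʳ 1#))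
  1≤[1+n]·1 (suc n) = ≤-trans (1≤[1+n]·1 n)
    (≤-respˡ-≈ (+-identityˡ _) (+-monoˡ-≤ (suc n · 1#) 0≤1))

  -- Characteristic zero, forced by the order. It makes the factorials invertible, which matters
  -- because `0# ⁻¹` is unspecified.
  n·1≉0 : ∀ n .{{_ : NonZero n}} → ¬ n · 1# ≈ 0#
  n·1≉0 (suc n) eq = 0≉1 (antisym 0≤1 (≤-respʳ-≈ eq (1≤[1+n]·1 n)))

  [a*b]⁻¹*a≈b⁻¹ : ∀ {a b} → ¬ a * b ≈ 0# → ¬ b ≈ 0# → (a * b) ⁻¹ * a ≈ b ⁻¹
  [a*b]⁻¹*a≈b⁻¹ {a} {b} ab≉0 b≉0 = begin
    (a * b) ⁻¹ * a                 ≈⟨ *-identityʳ _ ⟨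
    (a * b) ⁻¹ * a * 1#            ≈⟨ *-congˡ (⁻¹-inverseʳ b≉0) ⟨
    (a * b) ⁻¹ * a * (b * b ⁻¹)    ≈⟨ *-assoc _ _ _ ⟨
    (a * b) ⁻¹ * a * b * b ⁻¹      ≈⟨ *-congʳ (*-assoc _ _ _) ⟩
    (a * b) ⁻¹ * (a * b) * b ⁻¹    ≈⟨ *-congʳ (*-comm _ _) ⟩
    a * b * (a * b) ⁻¹ * b ⁻¹      ≈⟨ *-congʳ (⁻¹-inverseʳ ab≉0) ⟩
    1# * b ⁻¹                      ≈⟨ *-identityˡ _ ⟩
    b ⁻¹                           ∎

  -- The `suc k` copies of `s` stand for the extensions of each permutation; they cancel the extra
  -- factor in (k+1)! = (k+1) k!.
  1/[1+k]!-cancel : ∀ k s → _/_ ℝ 1 (suc k !) * (suc k · s) ≈ _/_ ℝ 1 (k !) * s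
  1/[1+k]!-cancel k s = begin
    1 · 1# * K′ ⁻¹ * (suc k · s)         ≈⟨ *-assoc _ _ _ ⟩
    1 · 1# * (K′ ⁻¹ * (suc k · s))       ≈⟨ *-congˡ (*-cong (⁻¹-cong K′≈) (sym suc-k·1*s)) ⟩
    1 · 1# * ((k′ * K) ⁻¹ * (k′ * s))    ≈⟨ *-congˡ (*-assoc _ _ _) ⟨
    1 · 1# * ((k′ * K) ⁻¹ * k′ * s)      ≈⟨ *-congˡ (*-congʳ ([a*b]⁻¹*a≈b⁻¹ k′K≉0 (n·1≉0 (k !) {{k !≢0}}))) ⟩
    1 · 1# * (K ⁻¹ * s)                  ≈⟨ *-assoc _ _ _ ⟨
    1 · 1# * K ⁻¹ * s                    ∎
    where
    K K′ k′ : Carrier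
    K  = (k !) · 1#
    K′ = (suc k !) · 1#
    k′ = suc k · 1#

    K′≈ : K′ ≈ k′ * K
    K′≈ = ×1-homo-* (suc k) (k !)

    k′K≉0 : ¬ k′ * K ≈ 0#
    k′K≉0 eq = n·1≉0 (suc k !) {{suc k !≢0}} (trans K′≈ eq)

    suc-k·1*s : k′ * s ≈ suc k · s
    suc-k·1*s = trans (×-assoc-* (suc k) 1# s) (×-congʳ (suc k) (*-identityˡ s))

  1-F[0]≈1 : 1# - F ℝ 0# ≈ 1#
  1-F[0]≈1 = begin
    1# - F ℝ 0#   ≈⟨ +-congˡ (-‿cong F[0]≈0) ⟩
    1# - 0#       ≈⟨ +-congˡ -0#≈0# ⟩
    1# + 0#       ≈⟨ +-identityʳ 1# ⟩
    1#            ∎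
    where
    F[0]≈0 : F ℝ 0# ≈ 0#
    -- At 0 the linear branch attains the minimum because 0 ≤ 1.
    F[0]≈0 = trans (x≤y⇒x⊓y≈x (≤-respˡ-≈ (sym (zeroʳ _)) 0≤1)) (zeroʳ _)

  -- Conditional factors replace a list that varies with the permutation by a fixed index set, from
  -- which the factor of a single coordinate can be split off.
  ∏-filter : ∀ {a p} {A : Set a} {P : Pred A p} (P? : Decidable P) (f : A → Carrier) as →
             ∏ ℝ (filter P? as) f ≈ ∏ ℝ as (λ a → if does (P? a) then f a else 1#)
  ∏-filter P? f []       = refl
  ∏-filter P? f (a ∷ as) with does (P? a)
  ... | true  = *-congˡ (∏-filter P? f as)
  ... | false = trans (∏-filter P? f as) (sym (*-identityˡ _))

  ∏-allFin : ∀ n (f : Fin n → Carrier) → ∏ ℝ (allFin n) f ≡ Product.sum f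
  ∏-allFin n f = ≡.trans (≡.cong (foldr _*_ 1#) (map-tabulate id f)) (product-tabulate f)
    where
    product-tabulate : ∀ {n} (f : Fin n → Carrier) →
                       foldr _*_ 1# (tabulate f) ≡ Product.sum f
    product-tabulate {zero}  f = ≡.refl
    product-tabulate {suc n} f = ≡.cong (f 0F *_) (product-tabulate (f ∘ suc))

  ∏-filter-allFin : ∀ {n p} {P : Pred (Fin n) p} (P? : Decidable P) (f : Fin n → Carrier) →
                    ∏ ℝ (filter P? (allFin n)) f ≈
                    Product.sum (λ i → if does (P? i) then f i else 1#)
  ∏-filter-allFin {n} P? f =
    trans (∏-filter P? f (allFin n)) (reflexive (∏-allFin n (λ i → if does (P? i) then f i else 1#)))

  -- The summand ignores the first component, so each `a` contributes one copy of the sum over `bs`.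
  -- In the application `a` is the rank given to the new coordinate.
  ∑-cartesianProductWith : ∀ {a b e} {A : Set a} {B : Set b} {E : Set e} (f : A → B → E)
                           {g : E → Carrier} {h : B → Carrier} → (∀ a b → g (f a b) ≈ h b) →
                           ∀ as bs → ∑ ℝ (cartesianProductWith f as bs) g ≈ length as · ∑ ℝ bs h
  ∑-cartesianProductWith f         gf≈h []       bs = refl
  ∑-cartesianProductWith f {g} {h} gf≈h (a ∷ as) bs =
    trans (∑-map-++ bs) (+-congˡ (∑-cartesianProductWith f gf≈h as bs))
    where
    es = cartesianProductWith f as bs

    ∑-map-++ : ∀ bs → ∑ ℝ (List.map (f a) bs ++ es) g ≈ ∑ ℝ bs h + ∑ ℝ es g
    ∑-map-++ []       = sym (+-identityˡ _)
    ∑-map-++ (b ∷ bs) = trans (+-cong (gf≈h a b) (∑-map-++ bs)) (sym (+-assoc _ _ _))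

  -- Describing `y` by its entries, not as an `insertAt`, admits a vector that visibly starts with
  -- x₁ and x₂. Propositional equality lets `F` and `F′` be rewritten by `≡.cong`, with no proof
  -- that they respect `≈`.
  module _ {n} {x : Vector Carrier n} {y : Vector Carrier (suc n)} (p : Fin (suc n))
           (y[p]≡0 : y p ≡ 0#) (y∖p≗x : removeAt y p ≗ x) where

    simplex-insert-0 : x ∈ Simplex ℝ n → y ∈ Simplex ℝ (suc n)
    simplex-insert-0 (0≤x , ∑x≈1) = 0≤y , (begin
      sum y                      ≈⟨ sum-remove {i = p} y ⟩
      y p + sum (removeAt y p)   ≡⟨ ≡.cong₂ _+_ y[p]≡0 (sum-cong-≗ y∖p≗x) ⟩
      0# + sum x                 ≈⟨ +-identityˡ _ ⟩
      sum x                      ≈⟨ ∑x≈1 ⟩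
      1#                         ∎)
      where
      0≤y : ∀ i → 0# ≤ y i
      0≤y i with p ≟ i
      ... | yes ≡.refl = ≤-reflexive (reflexive (≡.sym y[p]≡0))
      ... | no p≢i     = ≡.subst (λ i → 0# ≤ y i) (punchIn-punchOut p≢i)
                           (≤-respʳ-≈ (reflexive (≡.sym (y∖p≗x _))) (0≤x _))

    ∏-preceding-insert-0 : ∀ j π i →
      ∏ ℝ (preceding (insert p j π) (punchIn p i)) (λ l → 1# - F ℝ (y l)) ≈
      ∏ ℝ (preceding π i) (λ l → 1# - F ℝ (x l))
    ∏-preceding-insert-0 j π i = begin
      ∏ ℝ (preceding σ (punchIn p i)) (λ l → 1# - F ℝ (y l))
        ≈⟨ ∏-filter-allFin (λ l → (σ ⟨$⟩ʳ l) <? (σ ⟨$⟩ʳ punchIn p i)) (λ l → 1# - F ℝ (y l)) ⟩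
      Product.sum factors           ≈⟨ Product.sum-remove {i = p} factors ⟩
      factors p * Product.sum (removeAt factors p)
        ≈⟨ *-cong factors[p]≈1 (reflexive (Product.sum-cong-≗ factors∖p)) ⟩
      1# * Product.sum (λ l → if does ((π ⟨$⟩ʳ l) <? (π ⟨$⟩ʳ i)) then 1# - F ℝ (x l) else 1#)
        ≈⟨ *-identityˡ _ ⟩
      Product.sum (λ l → if does ((π ⟨$⟩ʳ l) <? (π ⟨$⟩ʳ i)) then 1# - F ℝ (x l) else 1#)
        ≈⟨ ∏-filter-allFin (λ l → (π ⟨$⟩ʳ l) <? (π ⟨$⟩ʳ i)) (λ l → 1# - F ℝ (x l)) ⟨
      ∏ ℝ (preceding π i) (λ l → 1# - F ℝ (x l)) ∎
      where
      σ : Permutation′ (suc n)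
      σ = insert p j π

      factors : Vector Carrier (suc n)
      factors l = if does ((σ ⟨$⟩ʳ l) <? (σ ⟨$⟩ʳ punchIn p i)) then 1# - F ℝ (y l) else 1#

      factors[p]≈1 : factors p ≈ 1#
      -- The factor is 1 - F(0) if `p` precedes and the default `1#` otherwise, so the rank `j` of
      -- `p` does not matter.
      factors[p]≈1 with does ((σ ⟨$⟩ʳ p) <? (σ ⟨$⟩ʳ punchIn p i))
      ... | true  = trans (reflexive (≡.cong (λ z → 1# - F ℝ z) y[p]≡0)) 1-F[0]≈1
      ... | false = refl

      factors∖p : ∀ l → factors (punchIn p l) ≡
                  (if does ((π ⟨$⟩ʳ l) <? (π ⟨$⟩ʳ i)) then 1# - F ℝ (x l) else 1#)
      factors∖p l = ≡.cong₂ (λ b z → if b then 1# - F ℝ z else 1#)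
        (does-⇔ (insert-<-⇔ p j π l i) (_ <? _) (_ <? _)) (y∖p≗x l)

    term-insert-0 : ∀ j π i → term ℝ y (insert p j π) (punchIn p i) ≈ term ℝ x π i
    term-insert-0 j π i =
      *-cong (reflexive (≡.cong (F′ ℝ) (y∖p≗x i))) (∏-preceding-insert-0 j π i)

  d-append-0 : ∀ m {x : Vector Carrier (2 ℕ.+ m)} {y : Vector Carrier (3 ℕ.+ m)} →
               y (fromℕ (2 ℕ.+ m)) ≡ 0# → removeAt y (fromℕ (2 ℕ.+ m)) ≗ x →
               d ℝ (suc m) y ≈ d ℝ m x
  d-append-0 m {x} {y} y[k]≡0 y∖k≗x = begin
    _/_ ℝ 1 (suc k !) * ∑ ℝ (permutations (suc k)) (λ σ → term ℝ y σ 0F + term ℝ y σ 1F)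
      -- The new coordinate is the last one because `permutations (suc k)` is built by insertion
      -- there. Since k is m + 2, `punchIn (fromℕ k)` fixes `0F` and `1F` by computation.
      ≈⟨ *-congˡ (∑-cartesianProductWith (insert (fromℕ k))
           (λ j π → +-cong (term-insert-0 (fromℕ k) y[k]≡0 y∖k≗x j π 0F)
                           (term-insert-0 (fromℕ k) y[k]≡0 y∖k≗x j π 1F))
           (allFin (suc k)) (permutations k)) ⟩
    _/_ ℝ 1 (suc k !) * (length (allFin (suc k)) · S)
      ≡⟨ ≡.cong (λ l → _/_ ℝ 1 (suc k !) * (l · S)) (length-tabulate {n = suc k} id) ⟩
    _/_ ℝ 1 (suc k !) * (suc k · S)
      ≈⟨ 1/[1+k]!-cancel k S ⟩
    _/_ ℝ 1 (k !) * S ∎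
    where
    k : ℕ
    k = 2 ℕ.+ m

    S : Carrier
    S = ∑ ℝ (permutations k) (λ σ → term ℝ x σ 0F + term ℝ x σ 1F)

  Values-⊆-suc : ∀ m {x₁ x₂ v} → v ∈ Values ℝ m x₁ x₂ → v ∈ Values ℝ (suc m) x₁ x₂
  Values-⊆-suc m {x₁} {x₂} (xs , x∈simplex , v≈d) =
    -- The index `fromℕ m` is the end of the tail; behind x₁ and x₂ it becomes `fromℕ (2 ℕ.+ m)`.
    insertAt xs (fromℕ m) 0# ,
    simplex-insert-0 (fromℕ (2 ℕ.+ m)) y[k]≡0 y∖k≗x x∈simplex ,
    trans v≈d (sym (d-append-0 m y[k]≡0 y∖k≗x))
    where
    y : Vector Carrier (3 ℕ.+ m)
    y = x₁ Vector.∷ x₂ Vector.∷ insertAt xs (fromℕ m) 0#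

    y[k]≡0 : y (fromℕ (2 ℕ.+ m)) ≡ 0#
    y[k]≡0 = insertAt-lookup xs (fromℕ m) 0#

    y∖k≗x : removeAt y (fromℕ (2 ℕ.+ m)) ≗ x₁ Vector.∷ x₂ Vector.∷ xs
    y∖k≗x 0F            = ≡.refl
    y∖k≗x 1F            = ≡.refl
    y∖k≗x (suc (suc i)) = removeAt-insertAt xs (fromℕ m) 0# i

lemma6p3 : ∀ {c ℓ₁ ℓ₂} (ℝ : CompleteOrderedField c ℓ₁ ℓ₂) →
    let open CompleteOrderedField ℝ in
    ∀ (m : ℕ) (x₁ x₂ : Carrier) →
    0# ≤ x₁ → 0# ≤ x₂ → x₁ + x₂ ≤ 1# → (m ≡ 0 → x₁ + x₂ ≈ 1#) →
    ∀ (Dₖ Dₖ₊₁ : Carrier) → IsD ℝ m x₁ x₂ Dₖ → IsD ℝ (suc m) x₁ x₂ Dₖ₊₁ →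
    Dₖ ≤ Dₖ₊₁
lemma6p3 ℝ m x₁ x₂ _ _ _ _ Dₖ _ (Dₖ∈values , _) (_ , Dₖ₊₁-upperBound) =
  -- The maximum `Dₖ` is attained, so it is also one of the values bounded by `Dₖ₊₁`.
  Dₖ₊₁-upperBound Dₖ (Values-⊆-suc ℝ m Dₖ∈values)
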